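{- Let $\{A_0=I_{n-1}, A_1, A_2={}^tA_1\}$ be a non-symmetric association scheme of rank $3$ and order $n-1$, and let $\sigma_k$ ($k\in K$) and $\tau_g$ ($g\in G\setminus K$) be the $4n\times 4n$ matrices constructed from it in the context. Then the set $\mathcal{Q}=\{\sigma_k\mid k\in K\}\cup\{\tau_g\mid g\in G\setminus K\}$ forms an association scheme.
   Context: ${}^tM$ is the transpose of $M$, $I_N$ the $N\times N$ identity matrix, $J_N$ the $N\times N$ all-ones matrix, $\otimes$ the Kronecker product. Association scheme: a set $\mathcal{S}=\{S_0,\dots,S_d\}$ of $d+1$ non-zero $N\times N$ matrices with entries in $\{0,1\}$ is an association scheme of order $N$ and rank $d+1$ if (1) $S_0=I_N$; (2) $\sum_{i=0}^d S_i=J_N$; (3) for all $0\le i,j\le d$, ${}^tS_i$ and $S_iS_j$ are linear combinations of $S_0,\dots,S_d$. It is symmetric if ${}^tS_i=S_i$ for all $i$, and non-symmetric otherwise. Group: let $x,y$ be the permutation matrices $$x=\begin{pmatrix}0&1&0&0\\0&0&1&0\\0&0&0&1\\1&0&0&0\end{pmatrix},\quad y=\begin{pmatrix}0&1&0&0\\1&0&0&0\\0&0&0&1\\0&0&1&0\end{pmatrix}$$ and $G=\langle x,y\rangle\cong D_8$ the group of order $8$ generated by them under matrix multiplication; its identity is $1=I_4$. Let $K=C_G(x)=\{1,x,x^2,x^3\}$, so $G\setminus K=\{y,xy,x^2y,x^3y\}$. Construction of $\mathcal{Q}$: given the scheme $\{A_0,A_1,A_2\}$ of order $n-1$ (it is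 known that then $n\equiv 0\pmod 4$), define $n\times n$ block matrices (blocks of sizes $1$ and $n-1$; $\mathbf{1}$ is the all-ones row vector of length $n-1$) $$\hat{A}_1=\begin{pmatrix}0&\mathbf{1}\\ 0&A_1\end{pmatrix},\qquad \hat{A}_2=\begin{pmatrix}0&0\\ {}^t\mathbf{1}&A_2\end{pmatrix}.$$ Define $4n\times 4n$ matrices $\sigma_k=I_n\otimes k$ for $k\in K$ and $\tau_g=\hat{A}_1\otimes g+\hat{A}_2\otimes gx^2$ for $g\in G\setminus K$. -}

module Defs where

open import Algebra.Properties.Monoid.Sum using (sum)
open import Data.Bool.Base using (if_then_else_)
open import Data.Fin.Base using (Fin; zero; suc; quotient; remainder)
open import Data.Fin.Properties using (_≟_)
open import Data.Nat.Base as ℕ using (ℕ; zero; suc)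
open import Data.Product.Base using (∃; ∃-syntax; _×_)
open import Data.Rational using (ℚ; 0ℚ; 1ℚ; _+_; _*_)
open import Data.Rational.Properties using (+-0-monoid)
open import Data.Sum.Base using (_⊎_)
open import Data.Vec.Functional using (Vector; []; _∷_; map; replicate; transpose)
open import Function.Bundles using (_⇔_)
open import Function.Definitions using (Injective)
open import Level using (0ℓ)
open import Relation.Binary.PropositionalEquality using (_≡_)
open import Relation.Nullary using (¬_; does)
open import Relation.Unary using (Pred; _∈_; _∪_; _∖_)

-- The choice of ℚ as the field of scalars is immaterial: the matrices of a
-- scheme are 0/1 with disjoint supports, so the coefficients of a linear
-- combination are entries of the matrix it represents.
Matrix : ℕ → Set
Matrix n = Vector (Vector ℚ n) n

private
  variable
    n d : ℕ

infix  4 _≋_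
infixl 6 _⊕_
infixl 7 _·_ _⊗_

-- Matrices are functions, so equality of matrices is entrywise, and sets of
-- matrices below are predicates closed under _≋_.
_≋_ : Matrix n → Matrix n → Set
M ≋ N = ∀ i j → M i j ≡ N i j

𝟎 : Matrix n
𝟎 i j = 0ℚ

I : Matrix n
I i j = if does (i ≟ j) then 1ℚ else 0ℚ

J : Matrix n
J i j = 1ℚ

_⊕_ : Matrix n → Matrix n → Matrix n
(M ⊕ N) i j = M i j + N i j

_·_ : Matrix n → Matrix n → Matrix n
(M · N) i j = sum +-0-monoid (λ k → M i k * N k j)

-- Row i * n + a of the Kronecker product has quotient i and remainder a.
_⊗_ : ∀ {m n} → Matrix m → Matrix n → Matrix (m ℕ.* n)
_⊗_ {m} {n} M N r s =
  M (quotient n r) (quotient n s) * N (remainder {m} n r) (remainder {m} n s)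

linearCombination : Vector ℚ d → Vector (Matrix n) d → Matrix n
linearCombination c S a b = sum +-0-monoid (λ i → c i * S i a b)

IsLinearCombinationOf : Vector (Matrix n) d → Pred (Matrix n) 0ℓ
IsLinearCombinationOf S M = ∃[ c ] M ≋ linearCombination c S

record IsAssociationScheme (S : Vector (Matrix n) (suc d)) : Set where
  field
    distinct  : Injective _≡_ _≋_ S
    nonZero   : ∀ i → ¬ (S i ≋ 𝟎)
    zeroOne   : ∀ i a b → S i a b ≡ 0ℚ ⊎ S i a b ≡ 1ℚ
    identity  : S zero ≋ I
    sum≋J     : (λ a b → sum +-0-monoid (λ i → S i a b)) ≋ J
    transposes : ∀ i → IsLinearCombinationOf S (transpose (S i))
    products   : ∀ i j → IsLinearCombinationOf S (S i · S j)

IsSymmetric : Vector (Matrix n) d → Set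
IsSymmetric S = ∀ i → transpose (S i) ≋ S i

-- A set of matrices is an association scheme if it can be listed, without
-- repetition, as S₀, …, S_d so that the axioms hold.
FormsAssociationScheme : Pred (Matrix n) 0ℓ → Set
FormsAssociationScheme {n} 𝒮 =
  ∃[ d ] ∃ λ (S : Vector (Matrix n) (suc d)) →
    IsAssociationScheme S × (∀ M → M ∈ 𝒮 ⇔ (∃[ i ] M ≋ S i))

data ⟨_,_⟩ (g h : Matrix n) : Pred (Matrix n) 0ℓ where
  generatorˡ : g ∈ ⟨ g , h ⟩
  generatorʳ : h ∈ ⟨ g , h ⟩
  one        : I ∈ ⟨ g , h ⟩
  product    : ∀ {a b} → a ∈ ⟨ g , h ⟩ → b ∈ ⟨ g , h ⟩ → a · b ∈ ⟨ g , h ⟩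
  inverse    : ∀ {a b} → a ∈ ⟨ g , h ⟩ → a · b ≋ I → b · a ≋ I → b ∈ ⟨ g , h ⟩
  respects   : ∀ {a b} → a ≋ b → a ∈ ⟨ g , h ⟩ → b ∈ ⟨ g , h ⟩

Centralizer : Pred (Matrix n) 0ℓ → Matrix n → Pred (Matrix n) 0ℓ
Centralizer H a b = b ∈ H × a · b ≋ b · a

Image : ∀ {m n} → (Matrix m → Matrix n) → Pred (Matrix m) 0ℓ → Pred (Matrix n) 0ℓ
Image f P M = ∃[ g ] g ∈ P × M ≋ f g

x y : Matrix 4
x = (0ℚ ∷ 1ℚ ∷ 0ℚ ∷ 0ℚ ∷ [])
  ∷ (0ℚ ∷ 0ℚ ∷ 1ℚ ∷ 0ℚ ∷ [])
  ∷ (0ℚ ∷ 0ℚ ∷ 0ℚ ∷ 1ℚ ∷ [])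
  ∷ (1ℚ ∷ 0ℚ ∷ 0ℚ ∷ 0ℚ ∷ [])
  ∷ []
y = (0ℚ ∷ 1ℚ ∷ 0ℚ ∷ 0ℚ ∷ [])
  ∷ (1ℚ ∷ 0ℚ ∷ 0ℚ ∷ 0ℚ ∷ [])
  ∷ (0ℚ ∷ 0ℚ ∷ 0ℚ ∷ 1ℚ ∷ [])
  ∷ (0ℚ ∷ 0ℚ ∷ 1ℚ ∷ 0ℚ ∷ [])
  ∷ []

G K : Pred (Matrix 4) 0ℓ
G = ⟨ x , y ⟩
K = Centralizer G x

hat₁ hat₂ : Matrix n → Matrix (suc n)
hat₁ {n} A₁ = (0ℚ ∷ replicate n 1ℚ) ∷ map (0ℚ ∷_) A₁
hat₂ {n} A₂ = (0ℚ ∷ replicate n 0ℚ) ∷ map (1ℚ ∷_) A₂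

σ : ∀ n → Matrix 4 → Matrix (n ℕ.* 4)
σ n k = I {n} ⊗ k

-- Here A₁ and A₂ have order n, so the blocks have order n + 1.
τ : Matrix n → Matrix n → Matrix 4 → Matrix (suc n ℕ.* 4)
τ A₁ A₂ g = hat₁ A₁ ⊗ g ⊕ hat₂ A₂ ⊗ (g · (x · x))

𝒬 : Matrix n → Matrix n → Pred (Matrix (suc n ℕ.* 4)) 0ℓ
𝒬 {n} A₁ A₂ = Image (σ (suc n)) K ∪ Image (τ A₁ A₂) (G ∖ K)

{-# OPTIONS --safe #-}

-- Let P = A₁ and Q = A₂. Since P and Q = ᵗP are disjoint 0/1 matrices, the
-- diagonals of PQ and QP are the row sums of P and Q, hence constant, and a
-- trace argument makes both equal to some r. The scheme then gives
-- P² + Q² = r (P + Q), and for H₁ = Â₁, H₂ = Â₂, H = H₁ + H₂ one finds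
--   H₁² + H₂² = r H,   H₁H₂ + H₂H₁ = (1 + 2r) I + r H.
-- Consequently τ_g τ_h = r H ⊗ (gh + ghx²) + (1 + 2r) σ_{ghx²}, and this lies
-- in the span of 𝒬 because 1 + x² = xy + x³y and x + x³ = y + x²y as matrices.
module Submission where

open import Defs
open import Algebra.Bundles using (CommutativeRing)
import Algebra.Properties.Group as GroupProperties
open import Data.Fin.Base using (Fin; zero; suc; _↑ˡ_; _↑ʳ_; splitAt; join; combine; quotient; remainder; remQuot)
open import Data.Fin.Patterns using (0F; 1F; 2F; 3F)
open import Data.Fin.Properties
  using (all?; any?; remQuot-combine; combine-remQuot; splitAt-join; join-splitAt)
  renaming (_≟_ to _≟ᶠ_)
open import Data.Nat.Base as ℕ using (ℕ; zero; suc)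
open import Data.Product.Base using (∃-syntax; _×_; _,_; proj₁; proj₂)
open import Data.Rational using (ℚ; 0ℚ; 1ℚ; _+_; _*_; _≟_; Positive)
open import Data.Rational.Properties
  using ( +-0-group; +-*-commutativeRing; +-assoc; +-comm; +-identityˡ; +-identityʳ
        ; *-assoc; *-comm; *-identityˡ; *-identityʳ; *-zeroˡ; *-zeroʳ; *-distribˡ-+; *-distribʳ-+
        ; ≤-antisym; ≤-reflexive; *-cancelˡ-≤-pos; pos⇒nonNeg; pos+nonNeg⇒pos )
open import Data.Rational.Solver using (module +-*-Solver)
open import Data.Sum.Base using (_⊎_; inj₁; inj₂; [_,_]′)
open import Data.Vec.Functional using (Vector; transpose; []; _∷_; _++_)
open import Function.Base using (_∘_; id)
open import Function.Bundles using (mk⇔)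
open import Relation.Binary.Bundles using (Setoid)
open import Relation.Binary.PropositionalEquality
  using (_≡_; _≢_; refl; sym; trans; cong; cong₂; subst; module ≡-Reasoning)
open import Relation.Nullary using (Dec; yes; no; ¬_; contradiction)
open import Relation.Nullary.Decidable using (from-yes; _×-dec_; _→-dec_; ¬?)
open import Relation.Unary using (_∈_; _∉_; _∖_)

open import Algebra.Properties.Semiring.Sum (CommutativeRing.semiring +-*-commutativeRing)
open GroupProperties +-0-group using (∙-cancelˡ; ∙-cancelʳ)
open +-*-Solver using (solve; _:=_; _:+_; _:*_; con)
open ≡-Reasoning

-- Separately, `H₁ · H₁` and `H₁ · H₂` need not lie in the span of `I`, `H₁`, `H₂`; only the
-- symmetrised sums do. Centrality of x² ensures that nothing else occurs: in τ_g τ_h both square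
-- terms carry gh = gx²hx² and both mixed terms carry ghx². As r H appears in both sums, what
-- remains besides σ is H ⊗ (gh + ghx²). The coincidence in the group identifies checkerboard
-- matrices: 1 + x² and xy + x³y both have a one exactly where row and column agree in parity, x +
-- x³ and y + x²y exactly where they differ. So gh + ghx² = t + tx² for some t in G ∖ K, and H ⊗ (t
-- + tx²) = τ_t + τ_{tx²}. The constant 1 + 2r is the order of the given scheme. The relation for P²
-- + Q² comes out first with an unknown constant s. Row sums give 2r s = 2r r, and cancelling 2r
-- requires ruling out order one.

private
  variable
    d m n : ℕ

-- Matrix algebra

∑-↑ : ∀ m n (f : Fin (m ℕ.+ n) → ℚ) → sum f ≡ sum (f ∘ (_↑ˡ n)) + sum (f ∘ (m ↑ʳ_))
∑-↑ zero    n f = sym (+-identityˡ _)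
∑-↑ (suc m) n f = trans (cong (f zero +_) (∑-↑ m n (f ∘ suc))) (sym (+-assoc (f zero) _ _))

∑-combine : ∀ m n (f : Fin (m ℕ.* n) → ℚ) → sum f ≡ ∑[ i < m ] ∑[ j < n ] f (combine i j)
∑-combine zero    n f = refl
∑-combine (suc m) n f =
  trans (∑-↑ n (m ℕ.* n) f) (cong (sum (f ∘ (_↑ˡ (m ℕ.* n))) +_) (∑-combine m n (f ∘ (n ↑ʳ_))))

I-diagonal : ∀ (i : Fin n) → I i i ≡ 1ℚ
I-diagonal i with i ≟ᶠ i
... | yes _  = refl
... | no i≢i = contradiction refl i≢i

I-off-diagonal : ∀ {i j : Fin n} → i ≢ j → I i j ≡ 0ℚ
I-off-diagonal {i = i} {j} i≢j with i ≟ᶠ j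
... | yes i≡j = contradiction i≡j i≢j
... | no _    = refl

I-symmetric : ∀ (i j : Fin n) → I i j ≡ I j i
I-symmetric i j with i ≟ᶠ j
... | yes refl = sym (I-diagonal i)
... | no i≢j   = sym (I-off-diagonal (i≢j ∘ sym))

I-suc : ∀ (i j : Fin n) → I (suc i) (suc j) ≡ I i j
I-suc i j with i ≟ᶠ j
... | yes _ = refl
... | no _  = refl

∑-zero : ∀ {f : Vector ℚ n} → (∀ i → f i ≡ 0ℚ) → sum f ≡ 0ℚ
∑-zero {n} f≡0 = trans (sum-cong-≗ f≡0) (sum-replicate-zero n)

∑-I : ∀ (i : Fin n) (f : Vector ℚ n) → ∑[ k < n ] (I i k * f k) ≡ f i
∑-I {suc n} zero f = begin
  1ℚ * f zero + ∑[ k < n ] (0ℚ * f (suc k))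
    ≡⟨ cong₂ _+_ (*-identityˡ (f zero)) (∑-zero (λ k → *-zeroˡ (f (suc k)))) ⟩
  f zero + 0ℚ
    ≡⟨ +-identityʳ (f zero) ⟩
  f zero ∎
∑-I {suc n} (suc i) f = begin
  0ℚ * f zero + ∑[ k < n ] (I (suc i) (suc k) * f (suc k))
    ≡⟨ cong₂ _+_ (*-zeroˡ (f zero)) (sum-cong-≗ (λ k → cong (_* f (suc k)) (I-suc i k))) ⟩
  0ℚ + ∑[ k < n ] (I i k * f (suc k))
    ≡⟨ +-identityˡ _ ⟩
  ∑[ k < n ] (I i k * f (suc k))
    ≡⟨ ∑-I i (f ∘ suc) ⟩
  f (suc i) ∎

-- The order of a matrix stays in the form `∑[ i < n ] 1ℚ`, a rational from the start, so counting
-- arguments need no embedding of ℕ into ℚ.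
∑-constant : ∀ (q : ℚ) → ∑[ i < n ] q ≡ q * ∑[ i < n ] 1ℚ
∑-constant {n} q = trans (sum-cong-≗ {n} (λ _ → sym (*-identityʳ q))) (sym (*-distribˡ-sum {n} q (λ _ → 1ℚ)))

≋-setoid : ℕ → Setoid _ _
≋-setoid n = record
  { Carrier       = Matrix n
  ; _≈_           = _≋_
  ; isEquivalence = record
    { refl  = λ i j → refl
    ; sym   = λ p i j → sym (p i j)
    ; trans = λ p q i j → trans (p i j) (q i j)
    }
  }

module ≋ {n} = Setoid (≋-setoid n)

⊕-cong : ∀ {M M′ N N′ : Matrix n} → M ≋ M′ → N ≋ N′ → M ⊕ N ≋ M′ ⊕ N′
⊕-cong p q i j = cong₂ _+_ (p i j) (q i j)

·-cong : ∀ {M M′ N N′ : Matrix n} → M ≋ M′ → N ≋ N′ → M · N ≋ M′ · N′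
·-cong p q i j = sum-cong-≗ (λ k → cong₂ _*_ (p i k) (q k j))

·-congˡ : ∀ (M : Matrix n) {N N′} → N ≋ N′ → M · N ≋ M · N′
·-congˡ M = ·-cong (≋.refl {x = M})

·-congʳ : ∀ (N : Matrix n) {M M′} → M ≋ M′ → M · N ≋ M′ · N
·-congʳ N p = ·-cong p (≋.refl {x = N})

·-identityˡ : ∀ (M : Matrix n) → I · M ≋ M
·-identityˡ M i j = ∑-I i (λ k → M k j)

·-identityʳ : ∀ (M : Matrix n) → M · I ≋ M
·-identityʳ {n} M i j = begin
  ∑[ k < n ] (M i k * I k j) ≡⟨ sum-cong-≗ (λ k → trans (*-comm (M i k) (I k j)) (cong (_* M i k) (I-symmetric k j))) ⟩
  ∑[ k < n ] (I j k * M i k) ≡⟨ ∑-I j (M i) ⟩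
  M i j                      ∎

·-assoc : ∀ (L M N : Matrix n) → (L · M) · N ≋ L · (M · N)
·-assoc {n} L M N i j = begin
  ∑[ k < n ] ((∑[ l < n ] (L i l * M l k)) * N k j)
    ≡⟨ sum-cong-≗ (λ k → *-distribʳ-sum (N k j) (λ l → L i l * M l k)) ⟩
  ∑[ k < n ] ∑[ l < n ] (L i l * M l k * N k j)
    ≡⟨ ∑-comm (λ k l → L i l * M l k * N k j) ⟩
  ∑[ l < n ] ∑[ k < n ] (L i l * M l k * N k j)
    ≡⟨ sum-cong-≗ (λ l → sum-cong-≗ (λ k → *-assoc (L i l) (M l k) (N k j))) ⟩
  ∑[ l < n ] ∑[ k < n ] (L i l * (M l k * N k j))
    ≡⟨ sum-cong-≗ (λ l → *-distribˡ-sum (L i l) (λ k → M l k * N k j)) ⟨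
  ∑[ l < n ] (L i l * ∑[ k < n ] (M l k * N k j)) ∎

·-distribˡ-⊕ : ∀ (L M N : Matrix n) → L · (M ⊕ N) ≋ L · M ⊕ L · N
·-distribˡ-⊕ L M N i j = trans
  (sum-cong-≗ (λ k → *-distribˡ-+ (L i k) (M k j) (N k j)))
  (∑-distrib-+ (λ k → L i k * M k j) (λ k → L i k * N k j))

·-distribʳ-⊕ : ∀ (L M N : Matrix n) → (M ⊕ N) · L ≋ M · L ⊕ N · L
·-distribʳ-⊕ L M N i j = trans
  (sum-cong-≗ (λ k → *-distribʳ-+ (L k j) (M i k) (N i k)))
  (∑-distrib-+ (λ k → M i k * L k j) (λ k → N i k * L k j))

-- The constructor `inverse` of the generated group admits an arbitrary matrix `b`; this identifies
-- it with a known inverse.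
inverse-unique : ∀ (l a : Matrix n) {b} → l · a ≋ I → a · b ≋ I → b ≋ l
inverse-unique l a {b} la≋I ab≋I i j = begin
  b i j             ≡⟨ ·-identityˡ b i j ⟨
  (I · b) i j       ≡⟨ ·-congʳ b la≋I i j ⟨
  ((l · a) · b) i j ≡⟨ ·-assoc l a b i j ⟩
  (l · (a · b)) i j ≡⟨ ·-congˡ l ab≋I i j ⟩
  (l · I) i j       ≡⟨ ·-identityʳ l i j ⟩
  l i j             ∎

⊗-cong : ∀ {M M′ : Matrix m} {N N′ : Matrix n} → M ≋ M′ → N ≋ N′ → M ⊗ N ≋ M′ ⊗ N′
⊗-cong p q r s = cong₂ _*_ (p _ _) (q _ _)

⊗-combine : ∀ (M : Matrix m) (N : Matrix n) i j a b →
            (M ⊗ N) (combine i a) (combine j b) ≡ M i j * N a b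
⊗-combine M N i j a b = cong₂ (λ u v → M (proj₁ u) (proj₁ v) * N (proj₂ u) (proj₂ v))
  (remQuot-combine i a) (remQuot-combine j b)

*-interchange : ∀ a b c d → (a * b) * (c * d) ≡ (a * c) * (b * d)
*-interchange = solve 4 (λ a b c d → (a :* b) :* (c :* d) := (a :* c) :* (b :* d)) refl

-- Splitting the summation index into block and offset separates each summand into a factor for the
-- block and one for the offset, so the double sum factors.
⊗-·-interchange : ∀ (M P : Matrix m) (N Q : Matrix n) → (M ⊗ N) · (P ⊗ Q) ≋ (M · P) ⊗ (N · Q)
⊗-·-interchange {m} {n} M P N Q r s = begin
  sum (F ∘ remQuot {m} n)
    ≡⟨ ∑-combine m n (F ∘ remQuot {m} n) ⟩
  ∑[ i < m ] ∑[ a < n ] F (remQuot {m} n (combine i a))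
    ≡⟨ sum-cong-≗ (λ i → sum-cong-≗ (λ a → trans (cong F (remQuot-combine i a))
         (*-interchange (M (q r) i) (N (e r) a) (P i (q s)) (Q a (e s))))) ⟩
  ∑[ i < m ] ∑[ a < n ] ((M (q r) i * P i (q s)) * (N (e r) a * Q a (e s)))
    ≡⟨ sum-cong-≗ (λ i → *-distribˡ-sum (M (q r) i * P i (q s)) (λ a → N (e r) a * Q a (e s))) ⟨
  ∑[ i < m ] ((M (q r) i * P i (q s)) * (N · Q) (e r) (e s))
    ≡⟨ *-distribʳ-sum ((N · Q) (e r) (e s)) (λ i → M (q r) i * P i (q s)) ⟨
  (M · P) (q r) (q s) * (N · Q) (e r) (e s) ∎
  where
  q : Fin (m ℕ.* n) → Fin m
  q = quotient n
  e : Fin (m ℕ.* n) → Fin n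
  e = remainder {m} n
  F : Fin m × Fin n → ℚ
  F (i , a) = (M (q r) i * N (e r) a) * (P i (q s) * Q a (e s))

I⊗I≋I : I {m} ⊗ I {n} ≋ I
I⊗I≋I {m} {n} r s with r ≟ᶠ s
... | yes refl = cong₂ _*_ (I-diagonal (quotient {m} n r)) (I-diagonal (remainder {m} n r))
... | no r≢s with quotient {m} n r ≟ᶠ quotient {m} n s
...   | no _ = *-zeroˡ (I (remainder {m} n r) (remainder {m} n s))
...   | yes q≡ = trans (cong (1ℚ *_) (I-off-diagonal λ e≡ → r≢s (begin
          r                                                    ≡⟨ combine-remQuot {m} n r ⟨
          combine (quotient {m} n r) (remainder {m} n r)       ≡⟨ cong₂ combine q≡ e≡ ⟩
          combine (quotient {m} n s) (remainder {m} n s)       ≡⟨ combine-remQuot {m} n s ⟩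
          s                                                    ∎))) (*-zeroʳ 1ℚ)

-- Closure properties of the span

infixr 8 _•_
_•_ : ℚ → Matrix n → Matrix n
(c • M) i j = c * M i j

module _ (S : Vector (Matrix n) d) where

  span-member : ∀ i → IsLinearCombinationOf S (S i)
  span-member i = I i , λ a b → sym (∑-I i (λ k → S k a b))

  span-respects : ∀ {M N} → M ≋ N → IsLinearCombinationOf S N → IsLinearCombinationOf S M
  span-respects M≋N (c , N≋) = c , ≋.trans M≋N N≋

  span-⊕ : ∀ {M N} → IsLinearCombinationOf S M → IsLinearCombinationOf S N → IsLinearCombinationOf S (M ⊕ N)
  span-⊕ {M} {N} (c , M≋) (c′ , N≋) = (λ i → c i + c′ i) , λ a b → begin
    M a b + N a b
      ≡⟨ cong₂ _+_ (M≋ a b) (N≋ a b) ⟩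
    linearCombination c S a b + linearCombination c′ S a b
      ≡⟨ ∑-distrib-+ (λ i → c i * S i a b) (λ i → c′ i * S i a b) ⟨
    ∑[ i < d ] (c i * S i a b + c′ i * S i a b)
      ≡⟨ sum-cong-≗ (λ i → *-distribʳ-+ (S i a b) (c i) (c′ i)) ⟨
    ∑[ i < d ] ((c i + c′ i) * S i a b) ∎

  span-• : ∀ q {M} → IsLinearCombinationOf S M → IsLinearCombinationOf S (q • M)
  span-• q {M} (c , M≋) = (λ i → q * c i) , λ a b → begin
    q * M a b
      ≡⟨ cong (q *_) (M≋ a b) ⟩
    q * linearCombination c S a b
      ≡⟨ *-distribˡ-sum q (λ i → c i * S i a b) ⟩
    ∑[ i < d ] (q * (c i * S i a b))
      ≡⟨ sum-cong-≗ (λ i → *-assoc q (c i) (S i a b)) ⟨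
    ∑[ i < d ] (q * c i * S i a b) ∎

-- Association schemes of rank 3

*-cancelˡ-pos : ∀ p .{{_ : Positive p}} {q r} → p * q ≡ p * r → q ≡ r
*-cancelˡ-pos p eq = ≤-antisym
  (*-cancelˡ-≤-pos p (≤-reflexive eq))
  (*-cancelˡ-≤-pos p (≤-reflexive (sym eq)))

∑1-positive : ∀ n → Positive (∑[ i < suc n ] 1ℚ)
∑1-positive zero    = _
∑1-positive (suc n) = pos+nonNeg⇒pos 1ℚ ∑1 {{pos⇒nonNeg ∑1 {{∑1-positive n}}}}
  where
  ∑1 : ℚ
  ∑1 = ∑[ i < suc n ] 1ℚ

ZeroOne : ℚ → Set
ZeroOne q = q ≡ 0ℚ ⊎ q ≡ 1ℚ

zeroOne⇒idempotent : ∀ {q} → ZeroOne q → q * q ≡ q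
zeroOne⇒idempotent (inj₁ refl) = refl
zeroOne⇒idempotent (inj₂ refl) = refl

zeroOne-* : ∀ {p q} → ZeroOne p → ZeroOne q → ZeroOne (p * q)
zeroOne-* {q = q} (inj₁ refl) _ = inj₁ (*-zeroˡ q)
zeroOne-* {q = q} (inj₂ refl) zo = subst ZeroOne (sym (*-identityˡ q)) zo

-- If `b` and `c` were both one, the sum would evaluate to 2 or 3.
exclusive : ∀ {a b c} → ZeroOne a → ZeroOne b → ZeroOne c → a + (b + c) ≡ 1ℚ → b ≡ 0ℚ ⊎ c ≡ 0ℚ
exclusive _           (inj₁ b≡0)  _           _  = inj₁ b≡0
exclusive _           (inj₂ _)    (inj₁ c≡0)  _  = inj₂ c≡0
exclusive (inj₁ refl) (inj₂ refl) (inj₂ refl) ()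
exclusive (inj₂ refl) (inj₂ refl) (inj₂ refl) ()

I-zeroOne : ∀ (i j : Fin n) → ZeroOne (I i j)
I-zeroOne i j with i ≟ᶠ j
... | yes _ = inj₂ refl
... | no _  = inj₁ refl

-- Constant row sums make the all-ones vector an eigenvector with eigenvalue `r`.
∑-·-self : ∀ (M : Matrix n) {r} → (∀ i → sum (M i) ≡ r) → ∀ i → sum ((M · M) i) ≡ r * r
∑-·-self {n} M {r} regular i = begin
  ∑[ j < n ] ∑[ k < n ] (M i k * M k j) ≡⟨ ∑-comm (λ j k → M i k * M k j) ⟩
  ∑[ k < n ] ∑[ j < n ] (M i k * M k j) ≡⟨ sum-cong-≗ (λ k → *-distribˡ-sum (M i k) (M k)) ⟨
  ∑[ k < n ] (M i k * sum (M k))        ≡⟨ sum-cong-≗ (λ k → cong (M i k *_) (regular k)) ⟩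
  ∑[ k < n ] (M i k * r)                ≡⟨ *-distribʳ-sum r (M i) ⟨
  sum (M i) * r                         ≡⟨ cong (_* r) (regular i) ⟩
  r * r                                 ∎

-- `P` is the adjacency matrix of a tournament with all in- and out-degrees `r`, and `Q` that of its
-- reversal. Given regularity, `squares` amounts to the usual condition that any two distinct
-- vertices have equally many common out-neighbours; this form is the one that survives bordering.
record IsDoublyRegularTournament (P Q : Matrix n) (r : ℚ) : Set where
  field
    transposed : ∀ i j → Q i j ≡ P j i
    zeroOneˡ   : ∀ i j → ZeroOne (P i j)
    zeroOneʳ   : ∀ i j → ZeroOne (Q i j)
    partition  : ∀ i j → I i j + (P i j + Q i j) ≡ 1ℚ
    rowSumˡ    : ∀ i → sum (P i) ≡ r
    rowSumʳ    : ∀ i → sum (Q i) ≡ r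
    order      : ∑[ i < n ] 1ℚ ≡ 1ℚ + (r + r)
    squares    : ∀ i j → (P · P) i j + (Q · Q) i j ≡ r * (P i j + Q i j)

  columnSumˡ : ∀ j → ∑[ i < n ] P i j ≡ r
  columnSumˡ j = trans (sum-cong-≗ (λ i → sym (transposed j i))) (rowSumʳ j)

  columnSumʳ : ∀ j → ∑[ i < n ] Q i j ≡ r
  columnSumʳ j = trans (sum-cong-≗ (λ i → transposed i j)) (rowSumˡ j)

  private
    E : Matrix n
    E = P ⊕ Q

    -- The matrix `I ⊕ E` is all ones, so `E · (I ⊕ E)` has the row sum of `E` in every entry.
    total : ∀ i j → E i j + (E · E) i j ≡ r + r
    total i j = begin
      E i j + ∑[ k < n ] (E i k * E k j)
        ≡⟨ cong (_+ (E · E) i j) (·-identityʳ E i j) ⟨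
      (E · I) i j + (E · E) i j
        ≡⟨ ·-distribˡ-⊕ E I E i j ⟨
      ∑[ k < n ] (E i k * (I k j + E k j))
        ≡⟨ sum-cong-≗ (λ k → trans (cong (E i k *_) (partition k j)) (*-identityʳ (E i k))) ⟩
      ∑[ k < n ] E i k
        ≡⟨ ∑-distrib-+ (P i) (Q i) ⟩
      sum (P i) + sum (Q i)
        ≡⟨ cong₂ _+_ (rowSumˡ i) (rowSumʳ i) ⟩
      r + r ∎

    expand : ∀ i j → (E · E) i j ≡ r * E i j + ((P · Q) i j + (Q · P) i j)
    expand i j = begin
      (E · E) i j
        ≡⟨ ·-distribˡ-⊕ E P Q i j ⟩
      (E · P) i j + (E · Q) i j
        ≡⟨ cong₂ _+_ (·-distribʳ-⊕ P P Q i j) (·-distribʳ-⊕ Q P Q i j) ⟩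
      ((P · P) i j + (Q · P) i j) + ((P · Q) i j + (Q · Q) i j)
        ≡⟨ solve 4 (λ a b c d → (a :+ b) :+ (c :+ d) := (a :+ d) :+ (c :+ b)) refl
             ((P · P) i j) ((Q · P) i j) ((P · Q) i j) ((Q · Q) i j) ⟩
      ((P · P) i j + (Q · Q) i j) + ((P · Q) i j + (Q · P) i j)
        ≡⟨ cong (_+ ((P · Q) i j + (Q · P) i j)) (squares i j) ⟩
      r * E i j + ((P · Q) i j + (Q · P) i j) ∎

  -- The leading `1ℚ` is what the border of the hat matrices adds to the core of the mixed products.
  -- The identity compares two expressions for `E · E`, one from `total` and one from `expand`.
  mixedProducts : ∀ i j → 1ℚ + ((P · Q) i j + (Q · P) i j) ≡ (1ℚ + (r + r)) * I i j + r * E i j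
  -- Adding `r * e` removes all subtractions: both sides then equal `δ + (r + r)`, since `δ + e` is
  -- 1.
  mixedProducts i j = ∙-cancelʳ (r * e) _ _ (begin
    (1ℚ + c) + r * e
      ≡⟨ cong (λ u → (u + c) + r * e) (partition i j) ⟨
    ((δ + e) + c) + r * e
      ≡⟨ solve 4 (λ δ e c s → ((δ :+ e) :+ c) :+ s := δ :+ (e :+ (s :+ c))) refl δ e c (r * e) ⟩
    δ + (e + (r * e + c))
      ≡⟨ cong (λ u → δ + (e + u)) (expand i j) ⟨
    δ + (e + (E · E) i j)
      ≡⟨ cong (δ +_) (total i j) ⟩
    δ + (r + r)
      ≡⟨ cong (δ +_) (*-identityʳ (r + r)) ⟨
    δ + (r + r) * 1ℚ
      ≡⟨ cong (λ u → δ + (r + r) * u) (partition i j) ⟨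
    δ + (r + r) * (δ + e)
      ≡⟨ solve 3 (λ δ e r → δ :+ (r :+ r) :* (δ :+ e) :=
           ((con 1ℚ :+ (r :+ r)) :* δ :+ r :* e) :+ r :* e) refl δ e r ⟩
    ((1ℚ + (r + r)) * δ + r * e) + r * e ∎)
    where
    δ e c : ℚ
    δ = I i j
    e = E i j
    c = (P · Q) i j + (Q · P) i j

-- From the scheme to a doubly regular tournament

module _ {A : Vector (Matrix (suc n)) 3} (scheme : IsAssociationScheme A)
         (A₂≋A₁ᵗ : A 2F ≋ transpose (A 1F)) where

  open IsAssociationScheme scheme

  private
    P Q : Matrix (suc n)
    P = A 1F
    Q = A 2F

    coefficient : Fin 3 → Fin 3 → Fin 3 → ℚ
    coefficient p q = proj₁ (products p q)

    r r′ : ℚ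
    r  = coefficient 1F 2F 0F
    r′ = coefficient 2F 1F 0F

    partition : ∀ i j → I i j + (P i j + Q i j) ≡ 1ℚ
    partition i j = trans
      (cong₂ _+_ (sym (identity i j)) (cong (P i j +_) (sym (+-identityʳ (Q i j)))))
      (sum≋J i j)

    disjoint : ∀ i j → P i j * Q i j ≡ 0ℚ
    disjoint i j with exclusive (I-zeroOne i j) (zeroOne 1F i j) (zeroOne 2F i j) (partition i j)
    ... | inj₁ p≡0 = trans (cong (_* Q i j) p≡0) (*-zeroˡ (Q i j))
    ... | inj₂ q≡0 = trans (cong (P i j *_) q≡0) (*-zeroʳ (P i j))

    -- On the diagonal `P` and its transpose agree, so idempotence turns the entry into a product of
    -- disjoint entries.
    P-diagonal : ∀ i → P i i ≡ 0ℚ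
    P-diagonal i = begin
      P i i         ≡⟨ zeroOne⇒idempotent (zeroOne 1F i i) ⟨
      P i i * P i i ≡⟨ cong (P i i *_) (A₂≋A₁ᵗ i i) ⟨
      P i i * Q i i ≡⟨ disjoint i i ⟩
      0ℚ            ∎

    -- Only the term of `A 0F` survives, because `P` and `Q` vanish on the diagonal.
    product-diagonal : ∀ p q i → (A p · A q) i i ≡ coefficient p q 0F
    product-diagonal p q i = begin
      (A p · A q) i i
        ≡⟨ proj₂ (products p q) i i ⟩
      c 0F * A 0F i i + (c 1F * P i i + (c 2F * Q i i + 0ℚ))
        ≡⟨ cong₂ _+_ (cong (c 0F *_) (trans (identity i i) (I-diagonal i)))
             (cong₂ _+_ (cong (c 1F *_) (P-diagonal i))
               (cong (λ u → c 2F * u + 0ℚ) (trans (A₂≋A₁ᵗ i i) (P-diagonal i)))) ⟩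
      c 0F * 1ℚ + (c 1F * 0ℚ + (c 2F * 0ℚ + 0ℚ))
        ≡⟨ solve 3 (λ a b c → a :* con 1ℚ :+ (b :* con 0ℚ :+ (c :* con 0ℚ :+ con 0ℚ)) := a) refl (c 0F) (c 1F) (c 2F) ⟩
      c 0F ∎
      where
      c : Fin 3 → ℚ
      c = coefficient p q

    -- Entries are idempotent, so a row sum of `P` is a diagonal entry of `P` times its transpose.
    P-rowSum : ∀ i → sum (P i) ≡ r
    P-rowSum i = begin
      sum (P i)
        ≡⟨ sum-cong-≗ (λ k → zeroOne⇒idempotent (zeroOne 1F i k)) ⟨
      ∑[ k < suc n ] (P i k * P i k)
        ≡⟨ sum-cong-≗ (λ k → cong (P i k *_) (A₂≋A₁ᵗ k i)) ⟨
      (P · Q) i i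
        ≡⟨ product-diagonal 1F 2F i ⟩
      r ∎

    Q-rowSum′ : ∀ i → sum (Q i) ≡ r′
    Q-rowSum′ i = begin
      sum (Q i)
        ≡⟨ sum-cong-≗ (λ k → zeroOne⇒idempotent (zeroOne 2F i k)) ⟨
      ∑[ k < suc n ] (Q i k * Q i k)
        ≡⟨ sum-cong-≗ (λ k → cong (Q i k *_) (A₂≋A₁ᵗ i k)) ⟩
      (Q · P) i i
        ≡⟨ product-diagonal 2F 1F i ⟩
      r′ ∎

    N : ℚ
    N = ∑[ i < suc n ] 1ℚ

    -- The ones of `P` are counted by rows and by columns; its columns are the rows of `Q`.
    r≡r′ : r ≡ r′
    r≡r′ = *-cancelˡ-pos N {{∑1-positive n}} (begin
      N * r                                  ≡⟨ *-comm N r ⟩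
      r * N                                  ≡⟨ ∑-constant {suc n} r ⟨
      ∑[ i < suc n ] r                       ≡⟨ sum-cong-≗ P-rowSum ⟨
      ∑[ i < suc n ] ∑[ j < suc n ] P i j    ≡⟨ ∑-comm P ⟩
      ∑[ j < suc n ] ∑[ i < suc n ] P i j    ≡⟨ sum-cong-≗ (λ j → sum-cong-≗ (λ i → A₂≋A₁ᵗ j i)) ⟨
      ∑[ j < suc n ] sum (Q j)               ≡⟨ sum-cong-≗ Q-rowSum′ ⟩
      ∑[ j < suc n ] r′                      ≡⟨ ∑-constant {suc n} r′ ⟩
      r′ * N                                 ≡⟨ *-comm r′ N ⟩
      N * r′                                 ∎)

    Q-rowSum : ∀ i → sum (Q i) ≡ r
    Q-rowSum i = trans (Q-rowSum′ i) (sym r≡r′)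

    order : N ≡ 1ℚ + (r + r)
    order = begin
      ∑[ k < suc n ] 1ℚ
        ≡⟨ sum-cong-≗ (λ k → partition 0F k) ⟨
      ∑[ k < suc n ] (I {suc n} 0F k + (P 0F k + Q 0F k))
        ≡⟨ ∑-distrib-+ {suc n} (I 0F) (λ k → P 0F k + Q 0F k) ⟩
      sum (I {suc n} 0F) + ∑[ k < suc n ] (P 0F k + Q 0F k)
        ≡⟨ cong₂ _+_
             (trans (sum-cong-≗ (λ k → sym (*-identityʳ (I {suc n} 0F k)))) (∑-I {suc n} 0F (λ _ → 1ℚ)))
             (trans (∑-distrib-+ (P 0F) (Q 0F)) (cong₂ _+_ (P-rowSum 0F) (Q-rowSum 0F))) ⟩
      1ℚ + (r + r) ∎

    s : ℚ
    s = coefficient 1F 1F 1F + coefficient 1F 1F 2F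

    -- Transposition exchanges `P` and `Q`, so P² = aP + bQ forces Q² = aQ + bP, and the sum is
    -- symmetric in `P` and `Q`.
    squares′ : ∀ i j → (P · P) i j + (Q · Q) i j ≡ s * (P i j + Q i j)
    squares′ i j = begin
      (P · P) i j + (Q · Q) i j
        ≡⟨ cong₂ _+_ (PP i j) (trans QQ≡PPᵗ (PP j i)) ⟩
      (a * P i j + b * Q i j) + (a * P j i + b * Q j i)
        ≡⟨ cong₂ (λ u v → (a * P i j + b * Q i j) + (a * u + b * v)) (sym (A₂≋A₁ᵗ i j)) (A₂≋A₁ᵗ j i) ⟩
      (a * P i j + b * Q i j) + (a * Q i j + b * P i j)
        ≡⟨ solve 4 (λ a b p q → (a :* p :+ b :* q) :+ (a :* q :+ b :* p) := (a :+ b) :* (p :+ q)) refl a b (P i j) (Q i j) ⟩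
      s * (P i j + Q i j) ∎
      where
      a b c : ℚ
      a = coefficient 1F 1F 1F
      b = coefficient 1F 1F 2F
      c = coefficient 1F 1F 0F
      -- A diagonal entry of `P · P` sums products `P 0F k * Q 0F k`: no two vertices are joined in
      -- both directions.
      c≡0 : c ≡ 0ℚ
      c≡0 = trans (sym (product-diagonal 1F 1F 0F))
        (∑-zero (λ k → trans (cong (P 0F k *_) (sym (A₂≋A₁ᵗ 0F k))) (disjoint 0F k)))
      PP : ∀ i j → (P · P) i j ≡ a * P i j + b * Q i j
      PP i j = begin
        (P · P) i j
          ≡⟨ proj₂ (products 1F 1F) i j ⟩
        c * A 0F i j + (a * P i j + (b * Q i j + 0ℚ))
          ≡⟨ cong₂ _+_ (trans (cong (_* A 0F i j) c≡0) (*-zeroˡ (A 0F i j)))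
               (cong (a * P i j +_) (+-identityʳ (b * Q i j))) ⟩
        0ℚ + (a * P i j + b * Q i j)
          ≡⟨ +-identityˡ _ ⟩
        a * P i j + b * Q i j ∎
      QQ≡PPᵗ : (Q · Q) i j ≡ (P · P) j i
      QQ≡PPᵗ = sum-cong-≗ (λ k → trans (cong₂ _*_ (A₂≋A₁ᵗ i k) (A₂≋A₁ᵗ k j)) (*-comm (P k i) (P j k)))

    -- Both sides are the sum of row `0F` in `squares′`.
    [r+r]s≡[r+r]r : (r + r) * s ≡ (r + r) * r
    [r+r]s≡[r+r]r = begin
      (r + r) * s
        ≡⟨ *-comm (r + r) s ⟩
      s * (r + r)
        ≡⟨ cong (s *_) (trans (∑-distrib-+ (P 0F) (Q 0F)) (cong₂ _+_ (P-rowSum 0F) (Q-rowSum 0F))) ⟨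
      s * ∑[ j < suc n ] (P 0F j + Q 0F j)
        ≡⟨ *-distribˡ-sum s (λ j → P 0F j + Q 0F j) ⟩
      ∑[ j < suc n ] (s * (P 0F j + Q 0F j))
        ≡⟨ sum-cong-≗ (squares′ 0F) ⟨
      ∑[ j < suc n ] ((P · P) 0F j + (Q · Q) 0F j)
        ≡⟨ ∑-distrib-+ ((P · P) 0F) ((Q · Q) 0F) ⟩
      sum ((P · P) 0F) + sum ((Q · Q) 0F)
        ≡⟨ cong₂ _+_ (∑-·-self P P-rowSum 0F) (∑-·-self Q Q-rowSum 0F) ⟩
      r * r + r * r
        ≡⟨ *-distribʳ-+ r r r ⟨
      (r + r) * r ∎

    -- Here the order is at least two, and cancelling 1 from `order` leaves 2r as a non-empty sum of
    -- ones.
    r+r-positive : ∀ n′ → n ≡ suc n′ → Positive (r + r)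
    r+r-positive n′ refl = subst Positive (∙-cancelˡ 1ℚ (∑[ i < suc n′ ] 1ℚ) (r + r) order) (∑1-positive n′)

    s≡r : s ≡ r
    s≡r = byOrder n refl
      where
      byOrder : ∀ k → n ≡ k → s ≡ r
      -- In order one, `P` consists of a single diagonal entry and would be the zero matrix.
      byOrder zero    refl = contradiction (λ { 0F 0F → P-diagonal 0F }) (nonZero 1F)
      byOrder (suc k) refl = *-cancelˡ-pos (r + r) {{r+r-positive k refl}} [r+r]s≡[r+r]r

  scheme⇒doublyRegularTournament : ∃[ r ] IsDoublyRegularTournament (A 1F) (A 2F) r
  scheme⇒doublyRegularTournament = r , record
    { transposed = A₂≋A₁ᵗ
    ; zeroOneˡ   = zeroOne 1F
    ; zeroOneʳ   = zeroOne 2F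
    ; partition  = partition
    ; rowSumˡ    = P-rowSum
    ; rowSumʳ    = Q-rowSum
    ; order      = order
    ; squares    = λ i j → trans (squares′ i j) (cong (_* (P i j + Q i j)) s≡r)
    }

-- The bordered matrices

module _ {P Q : Matrix n} {r : ℚ} (tournament : IsDoublyRegularTournament P Q r) where

  open IsDoublyRegularTournament tournament

  private
    H₁ H₂ : Matrix (suc n)
    H₁ = hat₁ P
    H₂ = hat₂ Q

    ∑-const* : ∀ c (f : Vector ℚ n) → ∑[ k < n ] (c * f k) ≡ c * sum f
    ∑-const* c f = sym (*-distribˡ-sum c f)

    ∑-*const : ∀ c (f : Vector ℚ n) → ∑[ k < n ] (f k * c) ≡ sum f * c
    ∑-*const c f = sym (*-distribʳ-sum c f)

  hat-transposed : ∀ i j → H₂ i j ≡ H₁ j i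
  hat-transposed zero    zero    = refl
  hat-transposed zero    (suc j) = refl
  hat-transposed (suc i) zero    = refl
  hat-transposed (suc i) (suc j) = transposed i j

  hat-zeroOneˡ : ∀ i j → ZeroOne (H₁ i j)
  hat-zeroOneˡ zero    zero    = inj₁ refl
  hat-zeroOneˡ zero    (suc j) = inj₂ refl
  hat-zeroOneˡ (suc i) zero    = inj₁ refl
  hat-zeroOneˡ (suc i) (suc j) = zeroOneˡ i j

  hat-zeroOneʳ : ∀ i j → ZeroOne (H₂ i j)
  hat-zeroOneʳ i j = subst ZeroOne (sym (hat-transposed i j)) (hat-zeroOneˡ j i)

  hat-partition : ∀ i j → I i j + (H₁ i j + H₂ i j) ≡ 1ℚ
  hat-partition zero    zero    = refl
  hat-partition zero    (suc j) = refl
  hat-partition (suc i) zero    = refl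
  hat-partition (suc i) (suc j) = trans (cong (_+ (P i j + Q i j)) (I-suc i j)) (partition i j)

  -- Border entries reduce to a column sum of `P` or a row sum of `Q`, both `r`; in the core the
  -- border contributes nothing.
  hat-squares : ∀ i j → (H₁ · H₁) i j + (H₂ · H₂) i j ≡ r * (H₁ i j + H₂ i j)
  hat-squares zero zero = begin
    (0ℚ * 0ℚ + ∑[ k < n ] (1ℚ * 0ℚ)) + (0ℚ * 0ℚ + ∑[ k < n ] (0ℚ * 1ℚ))
      ≡⟨ cong₂ (λ u v → (0ℚ * 0ℚ + u) + (0ℚ * 0ℚ + v)) (∑-zero {n} (λ _ → refl)) (∑-zero {n} (λ _ → refl)) ⟩
    0ℚ
      ≡⟨ *-zeroʳ r ⟨
    r * (0ℚ + 0ℚ) ∎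
  hat-squares zero (suc j) = begin
    (0ℚ * 1ℚ + ∑[ k < n ] (1ℚ * P k j)) + (0ℚ * 0ℚ + ∑[ k < n ] (0ℚ * Q k j))
      ≡⟨ cong₂ (λ u v → (0ℚ * 1ℚ + u) + (0ℚ * 0ℚ + v))
           (trans (∑-const* 1ℚ (λ k → P k j)) (cong (1ℚ *_) (columnSumˡ j)))
           (∑-zero (λ k → *-zeroˡ (Q k j))) ⟩
    (0ℚ * 1ℚ + 1ℚ * r) + (0ℚ * 0ℚ + 0ℚ)
      ≡⟨ solve 1 (λ r → (con 0ℚ :* con 1ℚ :+ con 1ℚ :* r) :+ (con 0ℚ :* con 0ℚ :+ con 0ℚ) := r :* (con 1ℚ :+ con 0ℚ)) refl r ⟩
    r * (1ℚ + 0ℚ) ∎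
  hat-squares (suc i) zero = begin
    (0ℚ * 0ℚ + ∑[ k < n ] (P i k * 0ℚ)) + (1ℚ * 0ℚ + ∑[ k < n ] (Q i k * 1ℚ))
      ≡⟨ cong₂ (λ u v → (0ℚ * 0ℚ + u) + (1ℚ * 0ℚ + v))
           (∑-zero (λ k → *-zeroʳ (P i k)))
           (trans (∑-*const 1ℚ (Q i)) (cong (_* 1ℚ) (rowSumʳ i))) ⟩
    (0ℚ * 0ℚ + 0ℚ) + (1ℚ * 0ℚ + r * 1ℚ)
      ≡⟨ solve 1 (λ r → (con 0ℚ :* con 0ℚ :+ con 0ℚ) :+ (con 1ℚ :* con 0ℚ :+ r :* con 1ℚ) := r :* (con 0ℚ :+ con 1ℚ)) refl r ⟩
    r * (0ℚ + 1ℚ) ∎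
  hat-squares (suc i) (suc j) = begin
    (0ℚ * 1ℚ + (P · P) i j) + (1ℚ * 0ℚ + (Q · Q) i j)
      ≡⟨ cong₂ _+_ (+-identityˡ ((P · P) i j)) (+-identityˡ ((Q · Q) i j)) ⟩
    (P · P) i j + (Q · Q) i j
      ≡⟨ squares i j ⟩
    r * (P i j + Q i j) ∎

  -- The corner counts all vertices, which `order` turns into 1 + 2r, and the border again gives
  -- line sums. In the core the border adds an all-ones matrix, from `H₂ · H₁` only.
  hat-mixedProducts : ∀ i j → (H₁ · H₂) i j + (H₂ · H₁) i j ≡
                              (1ℚ + (r + r)) * I i j + r * (H₁ i j + H₂ i j)
  hat-mixedProducts zero zero = begin
    (0ℚ * 0ℚ + ∑[ k < n ] (1ℚ * 1ℚ)) + (0ℚ * 0ℚ + ∑[ k < n ] (0ℚ * 0ℚ))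
      ≡⟨ cong₂ (λ u v → (0ℚ * 0ℚ + u) + (0ℚ * 0ℚ + v)) order (∑-zero {n} (λ _ → refl)) ⟩
    (0ℚ * 0ℚ + (1ℚ + (r + r))) + (0ℚ * 0ℚ + 0ℚ)
      ≡⟨ solve 1 (λ r → (con 0ℚ :* con 0ℚ :+ (con 1ℚ :+ (r :+ r))) :+ (con 0ℚ :* con 0ℚ :+ con 0ℚ)
           := (con 1ℚ :+ (r :+ r)) :* con 1ℚ :+ r :* (con 0ℚ :+ con 0ℚ)) refl r ⟩
    (1ℚ + (r + r)) * 1ℚ + r * (0ℚ + 0ℚ) ∎
  hat-mixedProducts zero (suc j) = begin
    (0ℚ * 0ℚ + ∑[ k < n ] (1ℚ * Q k j)) + (0ℚ * 1ℚ + ∑[ k < n ] (0ℚ * P k j))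
      ≡⟨ cong₂ (λ u v → (0ℚ * 0ℚ + u) + (0ℚ * 1ℚ + v))
           (trans (∑-const* 1ℚ (λ k → Q k j)) (cong (1ℚ *_) (columnSumʳ j)))
           (∑-zero (λ k → *-zeroˡ (P k j))) ⟩
    (0ℚ * 0ℚ + 1ℚ * r) + (0ℚ * 1ℚ + 0ℚ)
      ≡⟨ solve 1 (λ r → (con 0ℚ :* con 0ℚ :+ con 1ℚ :* r) :+ (con 0ℚ :* con 1ℚ :+ con 0ℚ)
           := (con 1ℚ :+ (r :+ r)) :* con 0ℚ :+ r :* (con 1ℚ :+ con 0ℚ)) refl r ⟩
    (1ℚ + (r + r)) * 0ℚ + r * (1ℚ + 0ℚ) ∎
  hat-mixedProducts (suc i) zero = begin
    (0ℚ * 0ℚ + ∑[ k < n ] (P i k * 1ℚ)) + (1ℚ * 0ℚ + ∑[ k < n ] (Q i k * 0ℚ))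
      ≡⟨ cong₂ (λ u v → (0ℚ * 0ℚ + u) + (1ℚ * 0ℚ + v))
           (trans (∑-*const 1ℚ (P i)) (cong (_* 1ℚ) (rowSumˡ i)))
           (∑-zero (λ k → *-zeroʳ (Q i k))) ⟩
    (0ℚ * 0ℚ + r * 1ℚ) + (1ℚ * 0ℚ + 0ℚ)
      ≡⟨ solve 1 (λ r → (con 0ℚ :* con 0ℚ :+ r :* con 1ℚ) :+ (con 1ℚ :* con 0ℚ :+ con 0ℚ)
           := (con 1ℚ :+ (r :+ r)) :* con 0ℚ :+ r :* (con 0ℚ :+ con 1ℚ)) refl r ⟩
    (1ℚ + (r + r)) * 0ℚ + r * (0ℚ + 1ℚ) ∎
  hat-mixedProducts (suc i) (suc j) = begin
    (0ℚ * 0ℚ + (P · Q) i j) + (1ℚ * 1ℚ + (Q · P) i j)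
      ≡⟨ solve 2 (λ a b → (con 0ℚ :* con 0ℚ :+ a) :+ (con 1ℚ :* con 1ℚ :+ b) := con 1ℚ :+ (a :+ b)) refl
           ((P · Q) i j) ((Q · P) i j) ⟩
    1ℚ + ((P · Q) i j + (Q · P) i j)
      ≡⟨ mixedProducts i j ⟩
    (1ℚ + (r + r)) * I i j + r * (P i j + Q i j)
      ≡⟨ cong (λ u → (1ℚ + (r + r)) * u + r * (P i j + Q i j)) (I-suc i j) ⟨
    (1ℚ + (r + r)) * I (suc i) (suc j) + r * (P i j + Q i j) ∎

-- The dihedral group

infix 4 _≋?_

_≋?_ : ∀ (M N : Matrix n) → Dec (M ≋ N)
M ≋? N = all? λ i → all? λ j → M i j ≟ N i j

-- With this row convention a matrix product composes the maps from left to right.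
permutation : (Fin n → Fin n) → Matrix n
permutation π i = I (π i)

permutation-· : ∀ (π ρ : Fin n → Fin n) {φ} → (∀ i → ρ (π i) ≡ φ i) →
                permutation π · permutation ρ ≋ permutation φ
permutation-· π ρ ρπ≡φ i j =
  trans (∑-I (π i) (λ k → I (ρ k) j)) (cong (λ k → I k j) (ρπ≡φ i))

permutation-zeroOne : ∀ (π : Fin n → Fin n) i j → ZeroOne (permutation π i j)
permutation-zeroOne π i = I-zeroOne (π i)

permutation-injective : ∀ (π ρ : Fin n → Fin n) → permutation π ≋ permutation ρ → ∀ i → π i ≡ ρ i
permutation-injective π ρ eq i with ρ i ≟ᶠ π i | trans (sym (eq i (π i))) (I-diagonal (π i))
... | yes ρi≡πi | _ = sym ρi≡πi
... | no _      | ()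

permutation≋̸𝟎 : ∀ (π : Fin (suc n) → Fin (suc n)) → ¬ (permutation π ≋ 𝟎)
permutation≋̸𝟎 π eq = contradiction (trans (sym (I-diagonal (π zero))) (eq zero (π zero))) λ ()

-- Modulo 4, `rotate i` is a ↦ a + i and `reflect i` is a ↦ 1 - i - a. As tables they let every
-- identity in the group be decided by evaluation.
rotate reflect : Fin 4 → Fin 4 → Fin 4
rotate
  = (0F ∷ 1F ∷ 2F ∷ 3F ∷ [])
  ∷ (1F ∷ 2F ∷ 3F ∷ 0F ∷ [])
  ∷ (2F ∷ 3F ∷ 0F ∷ 1F ∷ [])
  ∷ (3F ∷ 0F ∷ 1F ∷ 2F ∷ [])
  ∷ []
reflect
  = (1F ∷ 0F ∷ 3F ∷ 2F ∷ [])
  ∷ (0F ∷ 3F ∷ 2F ∷ 1F ∷ [])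
  ∷ (3F ∷ 2F ∷ 1F ∷ 0F ∷ [])
  ∷ (2F ∷ 1F ∷ 0F ∷ 3F ∷ [])
  ∷ []

-- The elements xⁱ of K and xⁱy of G ∖ K.
rotation reflection : Vector (Matrix 4) 4
rotation   i = permutation (rotate i)
reflection i = permutation (reflect i)

-- Multiplication by x² sends the i-th rotation (reflection) to the opposite i-th one.
opposite : Vector (Fin 4) 4
opposite = 2F ∷ 3F ∷ 0F ∷ 1F ∷ []

opposite-involutive : ∀ i → opposite (opposite i) ≡ i
opposite-involutive = from-yes (all? λ i → opposite (opposite i) ≟ᶠ i)

infix 4 _then_≗_ _then_≗?_

_then_≗_ : (π ρ φ : Fin n → Fin n) → Set
π then ρ ≗ φ = ∀ i → ρ (π i) ≡ φ i

_then_≗?_ : ∀ (π ρ φ : Fin n → Fin n) → Dec (π then ρ ≗ φ)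
π then ρ ≗? φ = all? λ i → ρ (π i) ≟ᶠ φ i

-- Finite verifications in the dihedral group

abstract

  rotation-0 : rotation 0F ≋ I
  rotation-0 = from-yes (rotation 0F ≋? I)

  x≋rotation : x ≋ rotation 1F
  x≋rotation = from-yes (x ≋? rotation 1F)

  y≋reflection : y ≋ reflection 0F
  y≋reflection = from-yes (y ≋? reflection 0F)

  rotate-rotate : ∀ i j → ∃[ k ] rotate i then rotate j ≗ rotate k
  rotate-rotate = from-yes (all? λ i → all? λ j → any? λ k → rotate i then rotate j ≗? rotate k)

  -- One `k` serves both equations because x² is central; so multiplication by a rotation carries a
  -- pair g, gx² to another such pair.
  rotate-reflect : ∀ i j → ∃[ k ]
    (rotate i then reflect j ≗ reflect k ×
     rotate i then reflect (opposite j) ≗ reflect (opposite k))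
  rotate-reflect = from-yes (all? λ i → all? λ j → any? λ k →
    (rotate i then reflect j ≗? reflect k) ×-dec
    (rotate i then reflect (opposite j) ≗? reflect (opposite k)))

  reflect-rotate : ∀ i j → ∃[ k ]
    (reflect i then rotate j ≗ reflect k ×
     reflect (opposite i) then rotate j ≗ reflect (opposite k))
  reflect-rotate = from-yes (all? λ i → all? λ j → any? λ k →
    (reflect i then rotate j ≗? reflect k) ×-dec
    (reflect (opposite i) then rotate j ≗? reflect (opposite k)))

  -- A single factor x² moves the product to its opposite, two cancel. These are the four hypotheses
  -- of `twist-·-twist`.
  reflect-reflect : ∀ i j → ∃[ k ]
    (reflect i then reflect j ≗ rotate k ×
     reflect i then reflect (opposite j) ≗ rotate (opposite k) ×
     reflect (opposite i) then reflect j ≗ rotate (opposite k) ×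
     reflect (opposite i) then reflect (opposite j) ≗ rotate k)
  reflect-reflect = from-yes (all? λ i → all? λ j → any? λ k →
    (reflect i then reflect j ≗? rotate k) ×-dec
    (reflect i then reflect (opposite j) ≗? rotate (opposite k)) ×-dec
    (reflect (opposite i) then reflect j ≗? rotate (opposite k)) ×-dec
    (reflect (opposite i) then reflect (opposite j) ≗? rotate k))

  x² : x · x ≋ rotation 2F
  x² = ≋.trans (·-cong x≋rotation x≋rotation)
    (permutation-· (rotate 1F) (rotate 1F) (from-yes (rotate 1F then rotate 1F ≗? rotate 2F)))

  x³ : x · (x · x) ≋ rotation 3F
  x³ = ≋.trans (·-cong x≋rotation x²)
    (permutation-· (rotate 1F) (rotate 2F) (from-yes (rotate 1F then rotate 2F ≗? rotate 3F)))

  rotation-y : ∀ i → rotation i · y ≋ reflection i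
  rotation-y i = ≋.trans (·-congˡ (rotation i) y≋reflection)
    (permutation-· (rotate i) (reflect 0F) (from-yes (all? λ i → rotate i then reflect 0F ≗? reflect i) i))

  reflection-x² : ∀ i → reflection i · (x · x) ≋ reflection (opposite i)
  reflection-x² i = ≋.trans (·-congˡ (reflection i) x²)
    (permutation-· (reflect i) (rotate 2F) (from-yes (all? λ i → reflect i then rotate 2F ≗? reflect (opposite i)) i))

  x-rotation : ∀ i → x · rotation i ≋ rotation i · x
  x-rotation i a b = begin
    (x · rotation i) a b                   ≡⟨ ·-congʳ (rotation i) x≋rotation a b ⟩
    (rotation 1F · rotation i) a b         ≡⟨ permutation-· (rotate 1F) (rotate i) (λ _ → refl) a b ⟩
    permutation (rotate i ∘ rotate 1F) a b ≡⟨ permutation-· (rotate i) (rotate 1F) (commute i) a b ⟨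
    (rotation i · rotation 1F) a b         ≡⟨ ·-congˡ (rotation i) x≋rotation a b ⟨
    (rotation i · x) a b                   ∎
    where
    commute : ∀ i → rotate i then rotate 1F ≗ rotate i ∘ rotate 1F
    commute = from-yes (all? λ i → rotate i then rotate 1F ≗? rotate i ∘ rotate 1F)

  x-reflection : ∀ i → ¬ (x · reflection i ≋ reflection i · x)
  -- Both products are permutation matrices, so non-commutation is decided on the underlying maps.
  x-reflection i comm = from-yes (all? λ i → ¬? (reflect i then rotate 1F ≗? reflect i ∘ rotate 1F)) i
    (λ a → sym (permutation-injective (reflect i ∘ rotate 1F) (rotate 1F ∘ reflect i) xs≋sx a))
    where
    xs≋sx : permutation (reflect i ∘ rotate 1F) ≋ permutation (rotate 1F ∘ reflect i)
    xs≋sx a b = begin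
      permutation (reflect i ∘ rotate 1F) a b ≡⟨ permutation-· (rotate 1F) (reflect i) (λ _ → refl) a b ⟨
      (rotation 1F · reflection i) a b        ≡⟨ ·-congʳ (reflection i) x≋rotation a b ⟨
      (x · reflection i) a b                  ≡⟨ comm a b ⟩
      (reflection i · x) a b                  ≡⟨ ·-congˡ (reflection i) x≋rotation a b ⟩
      (reflection i · rotation 1F) a b        ≡⟨ permutation-· (reflect i) (rotate 1F) (λ _ → refl) a b ⟩
      permutation (rotate 1F ∘ reflect i) a b ∎

  -- The coincidence that makes 𝒬 closed under multiplication.
  rotation-pair : ∀ k → ∃[ l ]
    rotation k ⊕ rotation (opposite k) ≋ reflection l ⊕ reflection (opposite l)
  rotation-pair = from-yes (all? λ k → any? λ l →
    rotation k ⊕ rotation (opposite k) ≋? reflection l ⊕ reflection (opposite l))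

  rotation-inverse : ∀ i → ∃[ k ] rotation k · rotation i ≋ I
  rotation-inverse i =
    let k , eq = from-yes (all? λ i → any? λ k → rotate k then rotate i ≗? id) i
    in k , permutation-· (rotate k) (rotate i) eq

  reflection-inverse : ∀ i → reflection i · reflection i ≋ I
  reflection-inverse i = permutation-· (reflect i) (reflect i) (from-yes (all? λ i → reflect i then reflect i ≗? id) i)

  rotation-transpose : ∀ i → ∃[ k ] transpose (rotation i) ≋ rotation k
  rotation-transpose = from-yes (all? λ i → any? λ k → transpose (rotation i) ≋? rotation k)

  reflection-transpose : ∀ i → transpose (reflection i) ≋ reflection i
  reflection-transpose = from-yes (all? λ i → transpose (reflection i) ≋? reflection i)

  -- The rotations act sharply transitively on the four indices: exactly one takes `a` to `b`. The
  -- same holds for the reflections.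
  ∑-rotation : ∀ a b → ∑[ i < 4 ] rotation i a b ≡ 1ℚ
  ∑-rotation = from-yes ((λ a b → ∑[ i < 4 ] rotation i a b) ≋? J)

  ∑-reflection : ∀ a b → ∑[ i < 4 ] reflection i a b ≡ 1ℚ
  ∑-reflection = from-yes ((λ a b → ∑[ i < 4 ] reflection i a b) ≋? J)

  ∑-reflection-opposite : ∀ a b → ∑[ i < 4 ] reflection (opposite i) a b ≡ 1ℚ
  ∑-reflection-opposite = from-yes ((λ a b → ∑[ i < 4 ] reflection (opposite i) a b) ≋? J)

  rotation-injective : ∀ i j → rotation i ≋ rotation j → i ≡ j
  rotation-injective i j eq =
    from-yes (all? λ i → all? λ j → (rotate i 0F ≟ᶠ rotate j 0F) →-dec (i ≟ᶠ j)) i j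
      (permutation-injective (rotate i) (rotate j) eq 0F)

  reflection-injective : ∀ i j → reflection i ≋ reflection j → i ≡ j
  reflection-injective i j eq =
    from-yes (all? λ i → all? λ j → (reflect i 0F ≟ᶠ reflect j 0F) →-dec (i ≟ᶠ j)) i j
      (permutation-injective (reflect i) (reflect j) eq 0F)

  rotation≋̸𝟎 : ∀ i → ¬ (rotation i ≋ 𝟎)
  rotation≋̸𝟎 i = permutation≋̸𝟎 (rotate i)

  reflection≋̸𝟎 : ∀ i → ¬ (reflection i ≋ 𝟎)
  reflection≋̸𝟎 i = permutation≋̸𝟎 (reflect i)

-- The elements of the group and of the centralizer

rotation∈G : ∀ i → rotation i ∈ G
rotation∈G 0F = respects (≋.sym {x = rotation 0F} rotation-0) one
rotation∈G 1F = respects x≋rotation generatorˡ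
rotation∈G 2F = respects x² (product generatorˡ generatorˡ)
rotation∈G 3F = respects x³ (product generatorˡ (product generatorˡ generatorˡ))

reflection∈G : ∀ i → reflection i ∈ G
reflection∈G i = respects (rotation-y i) (product (rotation∈G i) generatorʳ)

G-elements : ∀ {g} → g ∈ G → (∃[ i ] g ≋ rotation i) ⊎ (∃[ i ] g ≋ reflection i)
G-elements generatorˡ = inj₁ (1F , x≋rotation)
G-elements generatorʳ = inj₂ (0F , y≋reflection)
G-elements one        = inj₁ (0F , ≋.sym {x = rotation 0F} rotation-0)
G-elements (product g∈G h∈G) with G-elements g∈G | G-elements h∈G
... | inj₁ (i , g≋) | inj₁ (j , h≋) =
  let k , ≋k = rotate-rotate i j in inj₁ (k , ≋.trans (·-cong g≋ h≋) (permutation-· (rotate i) (rotate j) ≋k))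
... | inj₁ (i , g≋) | inj₂ (j , h≋) =
  let k , ≋k , _ = rotate-reflect i j in inj₂ (k , ≋.trans (·-cong g≋ h≋) (permutation-· (rotate i) (reflect j) ≋k))
... | inj₂ (i , g≋) | inj₁ (j , h≋) =
  let k , ≋k , _ = reflect-rotate i j in inj₂ (k , ≋.trans (·-cong g≋ h≋) (permutation-· (reflect i) (rotate j) ≋k))
... | inj₂ (i , g≋) | inj₂ (j , h≋) =
  let k , ≋k , _ = reflect-reflect i j in inj₁ (k , ≋.trans (·-cong g≋ h≋) (permutation-· (reflect i) (reflect j) ≋k))
G-elements (inverse {g} {h} g∈G gh≋I _) with G-elements g∈G
... | inj₁ (i , g≋) =
  let k , ki≋I = rotation-inverse i
  in inj₁ (k , inverse-unique (rotation k) (rotation i) ki≋I (≋.trans (·-congʳ h (≋.sym {x = g} g≋)) gh≋I))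
... | inj₂ (i , g≋) =
  inj₂ (i , inverse-unique (reflection i) (reflection i) (reflection-inverse i) (≋.trans (·-congʳ h (≋.sym {x = g} g≋)) gh≋I))
G-elements (respects {g} {h} g≋h g∈G) with G-elements g∈G
... | inj₁ (i , g≋) = inj₁ (i , ≋.trans (≋.sym {x = g} g≋h) g≋)
... | inj₂ (i , g≋) = inj₂ (i , ≋.trans (≋.sym {x = g} g≋h) g≋)

commutes-respects : ∀ (a : Matrix n) {g h} → g ≋ h → a · g ≋ g · a → a · h ≋ h · a
commutes-respects a {g} g≋h comm =
  ≋.trans (·-congˡ a (≋.sym {x = g} g≋h)) (≋.trans comm (·-congʳ a g≋h))

rotation∈K : ∀ i → rotation i ∈ K
rotation∈K i = rotation∈G i , x-rotation i

reflection∉K : ∀ i → reflection i ∉ K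
reflection∉K i (_ , comm) = x-reflection i comm

K-elements : ∀ {g} → g ∈ K → ∃[ i ] g ≋ rotation i
K-elements (g∈G , comm) with G-elements g∈G
... | inj₁ rotated  = rotated
... | inj₂ (i , g≋) = contradiction (commutes-respects x g≋ comm) (x-reflection i)

G∖K-elements : ∀ {g} → g ∈ G ∖ K → ∃[ i ] g ≋ reflection i
G∖K-elements {g} (g∈G , g∉K) with G-elements g∈G
... | inj₁ (i , g≋)  = contradiction
  (g∈G , commutes-respects x (≋.sym {x = g} g≋) (x-rotation i)) g∉K
... | inj₂ reflected = reflected

-- The scheme 𝒬

-- This is the shape of `τ` with the second group element free, so that gx² can be replaced by a
-- listed reflection and the two elements can be exchanged.
twist : Matrix m → Matrix m → Matrix n → Matrix n → Matrix (m ℕ.* n)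
twist M₁ M₂ g g′ = M₁ ⊗ g ⊕ M₂ ⊗ g′

twist-cong : ∀ (M₁ M₂ : Matrix m) {g g′ h h′ : Matrix n} → g ≋ h → g′ ≋ h′ →
             twist M₁ M₂ g g′ ≋ twist M₁ M₂ h h′
twist-cong M₁ M₂ g≋h g′≋h′ = ⊕-cong (⊗-cong (≋.refl {x = M₁}) g≋h) (⊗-cong (≋.refl {x = M₂}) g′≋h′)

⊗-· : ∀ (M M′ : Matrix m) (g h : Matrix n) {k} → g · h ≋ k → (M ⊗ g) · (M′ ⊗ h) ≋ (M · M′) ⊗ k
⊗-· M M′ g h gh≋k = ≋.trans (⊗-·-interchange M M′ g h) (⊗-cong (≋.refl {x = M · M′}) gh≋k)

I⊗-·-twist : ∀ (M₁ M₂ : Matrix m) (k g g′ : Matrix n) {h h′} → k · g ≋ h → k · g′ ≋ h′ →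
             (I {m} ⊗ k) · twist M₁ M₂ g g′ ≋ twist M₁ M₂ h h′
I⊗-·-twist {m} M₁ M₂ k g g′ kg≋h kg′≋h′ = ≋.trans
  (·-distribˡ-⊕ (I {m} ⊗ k) (M₁ ⊗ g) (M₂ ⊗ g′))
  (⊕-cong (≋.trans (⊗-·-interchange I M₁ k g) (⊗-cong (·-identityˡ M₁) kg≋h))
          (≋.trans (⊗-·-interchange I M₂ k g′) (⊗-cong (·-identityˡ M₂) kg′≋h′)))

twist-·-I⊗ : ∀ (M₁ M₂ : Matrix m) (g g′ k : Matrix n) {h h′} → g · k ≋ h → g′ · k ≋ h′ →
             twist M₁ M₂ g g′ · (I {m} ⊗ k) ≋ twist M₁ M₂ h h′
twist-·-I⊗ {m} M₁ M₂ g g′ k gk≋h g′k≋h′ = ≋.trans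
  (·-distribʳ-⊕ (I {m} ⊗ k) (M₁ ⊗ g) (M₂ ⊗ g′))
  (⊕-cong (≋.trans (⊗-·-interchange M₁ I g k) (⊗-cong (·-identityʳ M₁) gk≋h))
          (≋.trans (⊗-·-interchange M₂ I g′ k) (⊗-cong (·-identityʳ M₂) g′k≋h′)))

-- Four products of group elements take only two values, `u` on equal and `v` on unequal indices of
-- `M₁`, `M₂`; collecting by value yields the symmetrised sums.
twist-·-twist : ∀ (M₁ M₂ : Matrix m) (g g′ h h′ : Matrix n) {u v} →
  g · h ≋ u → g · h′ ≋ v → g′ · h ≋ v → g′ · h′ ≋ u →
  twist M₁ M₂ g g′ · twist M₁ M₂ h h′ ≋
  twist (M₁ · M₁ ⊕ M₂ · M₂) (M₁ · M₂ ⊕ M₂ · M₁) u v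
twist-·-twist {m} {n} M₁ M₂ g g′ h h′ {u} {v} gh≋u gh′≋v g′h≋v g′h′≋u i j = begin
  (T · (M₁ ⊗ h ⊕ M₂ ⊗ h′)) i j
    ≡⟨ ·-distribˡ-⊕ T (M₁ ⊗ h) (M₂ ⊗ h′) i j ⟩
  (T · (M₁ ⊗ h)) i j + (T · (M₂ ⊗ h′)) i j
    ≡⟨ cong₂ _+_ (·-distribʳ-⊕ (M₁ ⊗ h) (M₁ ⊗ g) (M₂ ⊗ g′) i j)
                 (·-distribʳ-⊕ (M₂ ⊗ h′) (M₁ ⊗ g) (M₂ ⊗ g′) i j) ⟩
  (((M₁ ⊗ g) · (M₁ ⊗ h)) i j + ((M₂ ⊗ g′) · (M₁ ⊗ h)) i j) +
  (((M₁ ⊗ g) · (M₂ ⊗ h′)) i j + ((M₂ ⊗ g′) · (M₂ ⊗ h′)) i j)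
    ≡⟨ cong₂ _+_
         (cong₂ _+_ (⊗-· M₁ M₁ g h gh≋u i j) (⊗-· M₂ M₁ g′ h g′h≋v i j))
         (cong₂ _+_ (⊗-· M₁ M₂ g h′ gh′≋v i j) (⊗-· M₂ M₂ g′ h′ g′h′≋u i j)) ⟩
  (((M₁ · M₁) ⊗ u) i j + ((M₂ · M₁) ⊗ v) i j) + (((M₁ · M₂) ⊗ v) i j + ((M₂ · M₂) ⊗ u) i j)
    ≡⟨ collect ((M₁ · M₁) p q) ((M₂ · M₁) p q) ((M₁ · M₂) p q) ((M₂ · M₂) p q) (u a b) (v a b) ⟩
  twist (M₁ · M₁ ⊕ M₂ · M₂) (M₁ · M₂ ⊕ M₂ · M₁) u v i j ∎
  where
  T : Matrix (m ℕ.* n)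
  T = twist M₁ M₂ g g′
  p q : Fin m
  p = quotient n i
  q = quotient n j
  a b : Fin n
  a = remainder {m} n i
  b = remainder {m} n j
  collect : ∀ a b c d u v → (a * u + b * v) + (c * v + d * u) ≡ (a + d) * u + (c + b) * v
  collect = solve 6 (λ a b c d u v →
    (a :* u :+ b :* v) :+ (c :* v :+ d :* u) := (a :+ d) :* u :+ (c :+ b) :* v) refl

-- The part with coefficient `r` depends on `u` and `v` through `u ⊕ v` alone, so the pair can be
-- traded for `t`, `t′`. Expanding (M₁ + M₂) ⊗ (t + t′) gives the two twists.
twist-regroup : ∀ (M₁ M₂ L₁ L₂ : Matrix m) r s (u v t t′ : Matrix n) →
  (∀ i j → L₁ i j ≡ r * (M₁ i j + M₂ i j)) →
  (∀ i j → L₂ i j ≡ s * I i j + r * (M₁ i j + M₂ i j)) →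
  u ⊕ v ≋ t ⊕ t′ →
  twist L₁ L₂ u v ≋ r • (twist M₁ M₂ t t′ ⊕ twist M₁ M₂ t′ t) ⊕ s • (I {m} ⊗ v)
twist-regroup {m} {n} M₁ M₂ L₁ L₂ r s u v t t′ L₁≡ L₂≡ pair i j = begin
  L₁ p q * u a b + L₂ p q * v a b
    ≡⟨ cong₂ (λ f g → f * u a b + g * v a b) (L₁≡ p q) (L₂≡ p q) ⟩
  r * (M₁ p q + M₂ p q) * u a b + (s * I p q + r * (M₁ p q + M₂ p q)) * v a b
    ≡⟨ factor r (M₁ p q + M₂ p q) s (I p q) (u a b) (v a b) ⟩
  r * ((M₁ p q + M₂ p q) * (u a b + v a b)) + s * (I p q * v a b)
    ≡⟨ cong (λ w → r * ((M₁ p q + M₂ p q) * w) + s * (I p q * v a b)) (pair a b) ⟩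
  r * ((M₁ p q + M₂ p q) * (t a b + t′ a b)) + s * (I p q * v a b)
    ≡⟨ cong (λ w → r * w + s * (I p q * v a b)) (expand (M₁ p q) (M₂ p q) (t a b) (t′ a b)) ⟩
  (r • (twist M₁ M₂ t t′ ⊕ twist M₁ M₂ t′ t) ⊕ s • (I {m} ⊗ v)) i j ∎
  where
  p q : Fin m
  p = quotient n i
  q = quotient n j
  a b : Fin n
  a = remainder {m} n i
  b = remainder {m} n j
  factor : ∀ r h s δ u v → r * h * u + (s * δ + r * h) * v ≡ r * (h * (u + v)) + s * (δ * v)
  factor = solve 6 (λ r h s δ u v →
    r :* h :* u :+ (s :* δ :+ r :* h) :* v := r :* (h :* (u :+ v)) :+ s :* (δ :* v)) refl
  expand : ∀ f g t t′ → (f + g) * (t + t′) ≡ (f * t + g * t′) + (f * t′ + g * t)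
  expand = solve 4 (λ f g t t′ →
    (f :+ g) :* (t :+ t′) := (f :* t :+ g :* t′) :+ (f :* t′ :+ g :* t)) refl

twist-transpose : ∀ (M₁ M₂ : Matrix m) (g g′ : Matrix n) → (∀ i j → M₂ i j ≡ M₁ j i) →
                  transpose g ≋ g → transpose g′ ≋ g′ →
                  transpose (twist M₁ M₂ g g′) ≋ twist M₁ M₂ g′ g
twist-transpose M₁ M₂ g g′ M₂≡M₁ᵗ gᵗ≋g g′ᵗ≋g′ r s = trans
  (cong₂ _+_ (cong₂ _*_ (sym (M₂≡M₁ᵗ _ _)) (gᵗ≋g _ _)) (cong₂ _*_ (M₂≡M₁ᵗ _ _) (g′ᵗ≋g′ _ _)))
  (+-comm _ ((M₁ ⊗ g′) r s))

twist-zeroOne : ∀ (M₁ M₂ : Matrix m) (g g′ : Matrix n) →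
  (∀ i j → ZeroOne (M₁ i j)) → (∀ i j → ZeroOne (M₂ i j)) →
  (∀ i j → M₁ i j ≡ 0ℚ ⊎ M₂ i j ≡ 0ℚ) →
  (∀ a b → ZeroOne (g a b)) → (∀ a b → ZeroOne (g′ a b)) →
  ∀ r s → ZeroOne (twist M₁ M₂ g g′ r s)
twist-zeroOne {m} {n} M₁ M₂ g g′ zo₁ zo₂ disjoint zo zo′ r s = weighted _ _ _ _
  (zo₁ _ _) (zo₂ _ _) (disjoint (quotient {m} n r) (quotient n s)) (zo _ _) (zo′ _ _)
  where
  weighted : ∀ p q u v → ZeroOne p → ZeroOne q → p ≡ 0ℚ ⊎ q ≡ 0ℚ → ZeroOne u → ZeroOne v → ZeroOne (p * u + q * v)
  weighted p q u v zp zq (inj₁ refl) zu zv = subst ZeroOne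
    (sym (trans (cong (_+ q * v) (*-zeroˡ u)) (+-identityˡ (q * v)))) (zeroOne-* zq zv)
  weighted p q u v zp zq (inj₂ refl) zu zv = subst ZeroOne
    (sym (trans (cong (p * u +_) (*-zeroˡ v)) (+-identityʳ (p * u)))) (zeroOne-* zp zu)

module _ {P Q : Matrix (suc m)} {r : ℚ} (tournament : IsDoublyRegularTournament P Q r) where

  private
    n′ : ℕ
    -- The order is at least two, so block indices `0F` and `1F` both exist.
    n′ = suc (suc m)

    H₁ H₂ : Matrix n′
    H₁ = hat₁ P
    H₂ = hat₂ Q

    rotated reflected : Vector (Matrix (n′ ℕ.* 4)) 4
    rotated   i = σ n′ (rotation i)
    reflected i = twist H₁ H₂ (reflection i) (reflection (opposite i))

    -- By definition of `_++_`, `S i` is `member (splitAt 4 i)`; cases are thus taken on the two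
    -- families instead of on eight indices.
    member : Fin 4 ⊎ Fin 4 → Matrix (n′ ℕ.* 4)
    member = [ rotated , reflected ]′

    S : Vector (Matrix (n′ ℕ.* 4)) 8
    S = rotated ++ reflected

    q : Fin (n′ ℕ.* 4) → Fin n′
    q = quotient 4

    e : Fin (n′ ℕ.* 4) → Fin 4
    e = remainder {n′} 4

    σ≋rotated : ∀ {k} i → k ≋ rotation i → σ n′ k ≋ rotated i
    σ≋rotated i = ⊗-cong (≋.refl {x = I})

    τ≋reflected : ∀ {g} i → g ≋ reflection i → τ P Q g ≋ reflected i
    τ≋reflected i g≋ = twist-cong H₁ H₂ g≋ (≋.trans (·-congʳ (x · x) g≋) (reflection-x² i))

    𝒬-member : ∀ {M} → M ∈ 𝒬 P Q → ∃[ u ] M ≋ member u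
    𝒬-member (inj₁ (k , k∈K , M≋)) =
      let i , k≋ = K-elements k∈K in inj₁ i , ≋.trans M≋ (σ≋rotated i k≋)
    𝒬-member (inj₂ (g , g∈ , M≋)) =
      let i , g≋ = G∖K-elements g∈ in inj₂ i , ≋.trans M≋ (τ≋reflected i g≋)

    member-𝒬 : ∀ u {M} → M ≋ member u → M ∈ 𝒬 P Q
    member-𝒬 (inj₁ i) M≋ = inj₁ (rotation i , rotation∈K i , M≋)
    member-𝒬 (inj₂ i) M≋ = inj₂ (reflection i , (reflection∈G i , reflection∉K i) ,
      ≋.trans M≋ (≋.sym {x = τ P Q (reflection i)} (τ≋reflected i (≋.refl {x = reflection i}))))

    index : Fin n′ → Fin 4 → Fin (n′ ℕ.* 4)
    index = combine

    rotated-block : ∀ i p p′ a b → rotated i (index p a) (index p′ b) ≡ I p p′ * rotation i a b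
    rotated-block i p p′ = ⊗-combine {n′} I (rotation i) p p′

    reflected-block : ∀ i p p′ a b → reflected i (index p a) (index p′ b) ≡
                      H₁ p p′ * reflection i a b + H₂ p p′ * reflection (opposite i) a b
    reflected-block i p p′ a b = cong₂ _+_
      (⊗-combine H₁ (reflection i) p p′ a b) (⊗-combine H₂ (reflection (opposite i)) p p′ a b)

    -- In block (0, 0) only `I` is non-zero, in block (0, 1) only `H₁`, with value 1. These blocks
    -- recover the group element and tell the families apart.
    diagonalBlock offDiagonalBlock : Matrix (n′ ℕ.* 4) → Matrix 4
    diagonalBlock    M a b = M (index 0F a) (index 0F b)
    offDiagonalBlock M a b = M (index 0F a) (index 1F b)

    rotated-diagonal : ∀ i → diagonalBlock (rotated i) ≋ rotation i
    rotated-diagonal i a b = trans (rotated-block i 0F 0F a b) (*-identityˡ _)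

    reflected-diagonal : ∀ i → diagonalBlock (reflected i) ≋ 𝟎
    reflected-diagonal i a b = trans (reflected-block i 0F 0F a b)
      (cong₂ _+_ (*-zeroˡ (reflection i a b)) (*-zeroˡ (reflection (opposite i) a b)))

    reflected-offDiagonal : ∀ i → offDiagonalBlock (reflected i) ≋ reflection i
    reflected-offDiagonal i a b = trans (reflected-block i 0F 1F a b)
      (trans (cong₂ _+_ (*-identityˡ (reflection i a b)) (*-zeroˡ (reflection (opposite i) a b)))
        (+-identityʳ (reflection i a b)))

    rotated≋̸reflected : ∀ i j → ¬ (rotated i ≋ reflected j)
    rotated≋̸reflected i j eq = rotation≋̸𝟎 i λ a b →
      trans (sym (rotated-diagonal i a b)) (trans (eq (index 0F a) (index 0F b)) (reflected-diagonal j a b))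

    member-injective : ∀ u v → member u ≋ member v → u ≡ v
    member-injective (inj₁ i) (inj₁ j) eq = cong inj₁ (rotation-injective i j λ a b →
      trans (sym (rotated-diagonal i a b)) (trans (eq (index 0F a) (index 0F b)) (rotated-diagonal j a b)))
    member-injective (inj₁ i) (inj₂ j) eq = contradiction eq (rotated≋̸reflected i j)
    member-injective (inj₂ i) (inj₁ j) eq = contradiction (λ r s → sym (eq r s)) (rotated≋̸reflected j i)
    member-injective (inj₂ i) (inj₂ j) eq = cong inj₂ (reflection-injective i j λ a b →
      trans (sym (reflected-offDiagonal i a b)) (trans (eq (index 0F a) (index 1F b)) (reflected-offDiagonal j a b)))

    member≋̸𝟎 : ∀ u → ¬ (member u ≋ 𝟎)
    member≋̸𝟎 (inj₁ i) eq = rotation≋̸𝟎 i λ a b → trans (sym (rotated-diagonal i a b)) (eq (index 0F a) (index 0F b))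
    member≋̸𝟎 (inj₂ i) eq = reflection≋̸𝟎 i λ a b → trans (sym (reflected-offDiagonal i a b)) (eq (index 0F a) (index 1F b))

    member-zeroOne : ∀ u r s → ZeroOne (member u r s)
    member-zeroOne (inj₁ i) r s = zeroOne-* (I-zeroOne (q r) (q s)) (permutation-zeroOne (rotate i) (e r) (e s))
    member-zeroOne (inj₂ i) = twist-zeroOne H₁ H₂ (reflection i) (reflection (opposite i))
      (hat-zeroOneˡ tournament) (hat-zeroOneʳ tournament)
      (λ p p′ → exclusive (I-zeroOne p p′) (hat-zeroOneˡ tournament p p′)
        (hat-zeroOneʳ tournament p p′) (hat-partition tournament p p′))
      (permutation-zeroOne (reflect i)) (permutation-zeroOne (reflect (opposite i)))

    -- Each family of four sums to the all-ones matrix, leaving (I + H₁ + H₂) ⊗ J₄.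
    S-sum : ∀ r s → ∑[ i < 8 ] S i r s ≡ 1ℚ
    S-sum r s = begin
      ∑[ i < 8 ] S i r s
        ≡⟨ ∑-↑ 4 4 (λ i → S i r s) ⟩
      ∑[ i < 4 ] (δ * rotation i a b) + ∑[ i < 4 ] (h₁ * reflection i a b + h₂ * reflection (opposite i) a b)
        ≡⟨ cong₂ _+_ (sym (*-distribˡ-sum δ (λ i → rotation i a b)))
             (trans (∑-distrib-+ (λ i → h₁ * reflection i a b) (λ i → h₂ * reflection (opposite i) a b))
               (cong₂ _+_ (sym (*-distribˡ-sum h₁ (λ i → reflection i a b)))
                 (sym (*-distribˡ-sum h₂ (λ i → reflection (opposite i) a b))))) ⟩
      δ * ∑[ i < 4 ] rotation i a b + (h₁ * ∑[ i < 4 ] reflection i a b + h₂ * ∑[ i < 4 ] reflection (opposite i) a b)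
        ≡⟨ cong₂ _+_ (times-one δ (∑-rotation a b))
             (cong₂ _+_ (times-one h₁ (∑-reflection a b)) (times-one h₂ (∑-reflection-opposite a b))) ⟩
      δ + (h₁ + h₂)
        ≡⟨ hat-partition tournament (q r) (q s) ⟩
      1ℚ ∎
      where
      a b : Fin 4
      a = e r
      b = e s
      δ h₁ h₂ : ℚ
      δ  = I (q r) (q s)
      h₁ = H₁ (q r) (q s)
      h₂ = H₂ (q r) (q s)
      times-one : ∀ p {u} → u ≡ 1ℚ → p * u ≡ p
      times-one p u≡1 = trans (cong (p *_) u≡1) (*-identityʳ p)

    span-of-member : ∀ u → IsLinearCombinationOf S (member u)
    span-of-member u = subst (λ v → IsLinearCombinationOf S (member v)) (splitAt-join 4 4 u)
      (span-member S (join 4 4 u))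

    reflected-opposite : ∀ i → twist H₁ H₂ (reflection (opposite i)) (reflection i) ≋ reflected (opposite i)
    reflected-opposite i = twist-cong H₁ H₂ (≋.refl {x = reflection (opposite i)})
      (λ a b → cong (λ j → reflection j a b) (sym (opposite-involutive i)))

    rotated-transpose : ∀ i k → transpose (rotation i) ≋ rotation k → transpose (rotated i) ≋ rotated k
    rotated-transpose i k ≋k r s = cong₂ _*_ (I-symmetric (q s) (q r)) (≋k (e r) (e s))

    -- Transposition exchanges `H₁` and `H₂` but fixes the reflections, so τ_g becomes τ_{gx²}.
    reflected-transpose : ∀ i → transpose (reflected i) ≋ reflected (opposite i)
    reflected-transpose i = ≋.trans
      (twist-transpose H₁ H₂ (reflection i) (reflection (opposite i)) (hat-transposed tournament)
        (reflection-transpose i) (reflection-transpose (opposite i)))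
      (reflected-opposite i)

    member-transpose : ∀ u → IsLinearCombinationOf S (transpose (member u))
    member-transpose (inj₁ i) =
      let k , ≋k = rotation-transpose i
      in span-respects S (rotated-transpose i k ≋k) (span-of-member (inj₁ k))
    member-transpose (inj₂ i) =
      span-respects S (reflected-transpose i) (span-of-member (inj₂ (opposite i)))

    -- The identity matrix occurs only in the mixed products, which carry one factor x²; hence
    -- `opposite k` in the last term.
    reflected-reflected : ∀ i j k l →
      reflect i then reflect j ≗ rotate k →
      reflect i then reflect (opposite j) ≗ rotate (opposite k) →
      reflect (opposite i) then reflect j ≗ rotate (opposite k) →
      reflect (opposite i) then reflect (opposite j) ≗ rotate k →
      rotation k ⊕ rotation (opposite k) ≋ reflection l ⊕ reflection (opposite l) →
      reflected i · reflected j ≋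
        r • (reflected l ⊕ reflected (opposite l)) ⊕ (1ℚ + (r + r)) • rotated (opposite k)
    reflected-reflected i j k l ss ss′ s′s s′s′ pair = ≋.trans
      (twist-·-twist H₁ H₂ (reflection i) (reflection (opposite i)) (reflection j) (reflection (opposite j))
        (permutation-· (reflect i) (reflect j) ss)
        (permutation-· (reflect i) (reflect (opposite j)) ss′)
        (permutation-· (reflect (opposite i)) (reflect j) s′s)
        (permutation-· (reflect (opposite i)) (reflect (opposite j)) s′s′))
      (≋.trans
        (twist-regroup H₁ H₂ (H₁ · H₁ ⊕ H₂ · H₂) (H₁ · H₂ ⊕ H₂ · H₁) r (1ℚ + (r + r))
          (rotation k) (rotation (opposite k)) (reflection l) (reflection (opposite l))
          (hat-squares tournament) (hat-mixedProducts tournament) pair)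
        (λ a b → cong (λ w → r * (reflected l a b + w) + (1ℚ + (r + r)) * rotated (opposite k) a b)
          (reflected-opposite l a b)))

    member-product : ∀ u v → IsLinearCombinationOf S (member u · member v)
    member-product (inj₁ i) (inj₁ j) =
      let k , eq = rotate-rotate i j
      in span-respects S
           (≋.trans (⊗-·-interchange {n′} I I (rotation i) (rotation j))
             (⊗-cong (·-identityˡ I) (permutation-· (rotate i) (rotate j) eq)))
           (span-of-member (inj₁ k))
    member-product (inj₁ i) (inj₂ j) =
      let k , eq , eq′ = rotate-reflect i j
      in span-respects S
           (I⊗-·-twist H₁ H₂ (rotation i) (reflection j) (reflection (opposite j))
             (permutation-· (rotate i) (reflect j) eq)
             (permutation-· (rotate i) (reflect (opposite j)) eq′))
           (span-of-member (inj₂ k))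
    member-product (inj₂ i) (inj₁ j) =
      let k , eq , eq′ = reflect-rotate i j
      in span-respects S
           (twist-·-I⊗ H₁ H₂ (reflection i) (reflection (opposite i)) (rotation j)
             (permutation-· (reflect i) (rotate j) eq)
             (permutation-· (reflect (opposite i)) (rotate j) eq′))
           (span-of-member (inj₂ k))
    member-product (inj₂ i) (inj₂ j) =
      let k , ss , ss′ , s′s , s′s′ = reflect-reflect i j
          l , pair = rotation-pair k
      in span-respects S (reflected-reflected i j k l ss ss′ s′s s′s′ pair) (span-⊕ S
           (span-• S r (span-⊕ S (span-of-member (inj₂ l)) (span-of-member (inj₂ (opposite l)))))
           (span-• S (1ℚ + (r + r)) (span-of-member (inj₁ (opposite k)))))

    S-injective : ∀ {i j} → S i ≋ S j → i ≡ j
    S-injective {i} {j} eq = begin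
      i                      ≡⟨ join-splitAt 4 4 i ⟨
      join 4 4 (splitAt 4 i) ≡⟨ cong (join 4 4) (member-injective (splitAt 4 i) (splitAt 4 j) eq) ⟩
      join 4 4 (splitAt 4 j) ≡⟨ join-splitAt 4 4 j ⟩
      j                      ∎

    S-isAssociationScheme : IsAssociationScheme S
    S-isAssociationScheme = record
      { distinct   = S-injective
      ; nonZero    = member≋̸𝟎 ∘ splitAt 4
      ; zeroOne    = member-zeroOne ∘ splitAt 4
      ; identity   = ≋.trans (⊗-cong (≋.refl {x = I {n′}}) rotation-0) (I⊗I≋I {n′} {4})
      ; sum≋J      = S-sum
      ; transposes = member-transpose ∘ splitAt 4
      ; products   = λ i j → member-product (splitAt 4 i) (splitAt 4 j)
      }

  tournament⇒𝒬-scheme : FormsAssociationScheme (𝒬 P Q)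
  tournament⇒𝒬-scheme = 7 , S , S-isAssociationScheme , λ M → mk⇔
    (λ M∈𝒬 → let u , M≋ = 𝒬-member M∈𝒬
             in join 4 4 u , subst (λ v → M ≋ member v) (sym (splitAt-join 4 4 u)) M≋)
    (λ (i , M≋) → member-𝒬 (splitAt 4 i) M≋)

theorem3p10 : ∀ (m : ℕ) (A : Vector (Matrix m) 3) → IsAssociationScheme A → ¬ IsSymmetric A →
    A (suc (suc zero)) ≋ transpose (A (suc zero)) →
    FormsAssociationScheme (𝒬 (A (suc zero)) (A (suc (suc zero))))
-- A matrix of order zero is vacuously zero, against `nonZero`.
theorem3p10 zero    A scheme _ _ = contradiction (λ ()) (IsAssociationScheme.nonZero scheme zero)
theorem3p10 (suc m) A scheme _ A₂≋A₁ᵗ =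
  tournament⇒𝒬-scheme (proj₂ (scheme⇒doublyRegularTournament scheme A₂≋A₁ᵗ))
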